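{- Let $n$ be a positive even integer and $m = n^2+1$. Let $Q_n = (a_{i,j})_{1\le i,j\le n}$ be the $n\times n$ matrix with entries in $\mathbb{Z}/m\mathbb{Z}$ given by $a_{i,j} = j + (i-1)n$, and let $\rho(Q_n)$ be the $n\times n$ matrix whose $(i,j)$ entry is $a_{j,n-i+1}$. Writing $\left(\frac{A}{m}\right)$ for the matrix obtained by applying the Jacobi symbol $\left(\frac{\cdot}{m}\right)$ to each entry of $A$, we have $$\left(\frac{\rho(Q_n)}{m}\right) = \begin{cases} \left(\frac{Q_n}{m}\right) & \text{if } n\equiv 0 \pmod 4,\\ -\left(\frac{Q_n}{m}\right) & \text{if } n\equiv 2\pmod 4.\end{cases}$$
   Context: For odd $m>2$ with prime factorization $m=\prod_{k=1}^K p_k$ (primes not necessarily distinct), the Jacobi symbol is $\left(\frac{a}{m}\right)=\prod_{k=1}^K \left(\frac{a}{p_k}\right)$, where $\left(\frac{a}{p}\right)$ is the Legendre symbol; it is well-defined on $\mathbb{Z}/m\mathbb{Z}$. -}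

module Defs where

open import Data.Fin.Base using (Fin; toℕ; opposite)
open import Data.Fin.Properties using (any?)
open import Data.Integer.Base using (ℤ; +_; -_; _+_; _-_; _*_; 0ℤ; 1ℤ; -1ℤ)
open import Data.Integer.Divisibility.Signed using (_∣_; _∣?_; ∣-trans; ∣ᵤ⇒∣; ∣m∣n⇒∣m+n; ∣m∣n⇒∣m-n)
open import Data.Integer.Tactic.RingSolver using (solve-∀)
open import Data.List.Base using ([]; _∷_; foldr; map)
open import Data.Nat.Base as ℕ using (ℕ; suc; NonZero)
open import Data.Nat.Divisibility as ℕ∣ using ()
open import Data.Nat.DivMod using (_mod_)
open import Data.Nat.ListAction using (product)
open import Data.Nat.Primality.Factorisation using (PrimeFactorisation; factorise; factors)
open import Data.Product.Base using (∃; _,_)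
open import Level using (Level)
open import Relation.Binary.PropositionalEquality using (_≡_; refl; cong₂; subst)
open import Relation.Nullary using (Dec; yes; no; contradiction)

private
  variable
    ℓ ℓ′ : Level
    A : Set ℓ
    B : Set ℓ′

IsSquareMod : ℕ → ℤ → Set
IsSquareMod p a = ∃ λ (x : Fin p) → + p ∣ + toℕ x * + toℕ x - a

isSquareMod? : ∀ p a → Dec (IsSquareMod p a)
isSquareMod? p a = any? λ x → + p ∣? + toℕ x * + toℕ x - a

-- Meaningful for p an odd prime only.
legendre : ℤ → ℕ → ℤ
legendre a p with + p ∣? a
... | yes _ = 0ℤ
... | no  _ with isSquareMod? p a
...   | yes _ = 1ℤ
...   | no  _ = -1ℤ

-- Meaningful for m odd only; prime factors are taken with multiplicity.
jacobi : ℤ → (m : ℕ) .{{_ : NonZero m}} → ℤ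
jacobi a m = foldr _*_ 1ℤ (map (legendre a) (factors (factorise m)))

private
  shift : ∀ {d} a b → d ∣ a - b → d ∣ a → d ∣ b
  shift {d} a b d∣a-b d∣a = subst (d ∣_) (eq a b) (∣m∣n⇒∣m-n d∣a d∣a-b)
    where
    eq : ∀ a b → a - (a - b) ≡ b
    eq = solve-∀

  flip-diff : ∀ {d} a b → d ∣ a - b → d ∣ b - a
  flip-diff {d} a b d∣a-b = subst (d ∣_) (eq a b) (∣m∣n⇒∣m-n (∣m∣n⇒∣m-n d∣a-b d∣a-b) d∣a-b)
    where
    eq : ∀ a b → ((a - b) - (a - b)) - (a - b) ≡ b - a
    eq = solve-∀

  shift-square : ∀ p a b → + p ∣ a - b → IsSquareMod p a → IsSquareMod p b
  shift-square p a b p∣a-b (x , p∣x²-a) =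
    x , subst (+ p ∣_) (eq (+ toℕ x * + toℕ x) a b) (∣m∣n⇒∣m+n p∣x²-a p∣a-b)
    where
    eq : ∀ s a b → (s - a) + (a - b) ≡ s - b
    eq = solve-∀

legendre-cong : ∀ p a b → + p ∣ a - b → legendre a p ≡ legendre b p
legendre-cong p a b p∣a-b with + p ∣? a | + p ∣? b
... | yes _   | yes _   = refl
... | yes p∣a | no  p∤b = contradiction (shift a b p∣a-b p∣a) p∤b
... | no  p∤a | yes p∣b = contradiction (shift b a (flip-diff a b p∣a-b) p∣b) p∤a
... | no  _   | no  _ with isSquareMod? p a | isSquareMod? p b
...   | yes _  | yes _  = refl
...   | yes sa | no ¬sb = contradiction (shift-square p a b p∣a-b sa) ¬sb
...   | no ¬sa | yes sb = contradiction (shift-square p b a (flip-diff a b p∣a-b) sb) ¬sa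
...   | no  _  | no  _  = refl

jacobi-cong : ∀ m .{{_ : NonZero m}} a b → + m ∣ a - b → jacobi a m ≡ jacobi b m
jacobi-cong m a b m∣a-b =
  go (factors (factorise m))
     (subst (λ k → + k ∣ a - b) (PrimeFactorisation.isFactorisation (factorise m)) m∣a-b)
  where
  go : ∀ ps → + product ps ∣ a - b →
       foldr _*_ 1ℤ (map (legendre a) ps) ≡ foldr _*_ 1ℤ (map (legendre b) ps)
  go []       _ = refl
  go (p ∷ ps) d = cong₂ _*_
    (legendre-cong p a b (∣-trans (∣ᵤ⇒∣ (ℕ∣.m∣m*n (product ps))) d))
    (go ps (∣-trans (∣ᵤ⇒∣ (ℕ∣.n∣m*n p)) d))

-- Residue classes modulo m, each given by its least nonnegative representative.
ℤ/_ : ℕ → Set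
ℤ/ m = Fin m

-- By jacobi-cong, the choice of representative is immaterial.
jacobi/ : (m : ℕ) .{{_ : NonZero m}} → ℤ/ m → ℤ
jacobi/ m x = jacobi (+ toℕ x) m

Matrix : Set ℓ → ℕ → Set ℓ
Matrix A n = Fin n → Fin n → A

infix 4 _≋_
_≋_ : ∀ {n} → Matrix A n → Matrix A n → Set _
M ≋ N = ∀ i j → M i j ≡ N i j

mapᴹ : ∀ {n} → (A → B) → Matrix A n → Matrix B n
mapᴹ f M i j = f (M i j)

-ᴹ_ : ∀ {n} → Matrix ℤ n → Matrix ℤ n
-ᴹ_ = mapᴹ (-_)

-- Fin n is 0-based, so the 1-based column index n - i + 1 is opposite i.
ρ : ∀ {n} → Matrix A n → Matrix A n
ρ M i j = M j (opposite i)

-- The 1-based entry j + (i - 1) n.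
Q : (n : ℕ) → Matrix (ℤ/ suc (n ℕ.^ 2)) n
Q n i j = (suc (toℕ j) ℕ.+ toℕ i ℕ.* n) mod suc (n ℕ.^ 2)

jacobiMatrix : ∀ {n} (m : ℕ) .{{_ : NonZero m}} → Matrix (ℤ/ m) n → Matrix ℤ n
jacobiMatrix m = mapᴹ (jacobi/ m)

{-# OPTIONS --safe #-}
module Submission where

-- Since n² ≡ -1 modulo m = n² + 1, rotating Q n amounts to multiplying it by n, so everything
-- reduces to the symbol (n/m).  Euler's criterion gives (n/p) ≡ n^((p-1)/2) for every prime
-- p ∣ m; squaring forces p = 4k + 1, and then (n/p) = (-1)^k.  Numbers of the form 4k + 1 with
-- sign (-1)^k multiply compatibly, so (n/m) = (-1)^(n²/4).
-- Euler's criterion itself comes from pairing x with a / x in the product of all nonzero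
-- residues modulo p: there are no fixed points if a is not a square, and exactly two, ± b,
-- if a = b².

open import Defs
open import Data.Fin.Base as Fin using (Fin; toℕ; fromℕ<; opposite)
open import Data.Fin.Properties using (toℕ<n; toℕ-fromℕ<; toℕ-injective; opposite-prop)
open import Data.Integer.Base as ℤ using (ℤ; +_; -_; 0ℤ; 1ℤ; -1ℤ; ∣_∣; _%ℕ_; _/ℕ_)
import Data.Integer.DivMod as ℤDivMod
import Data.Integer.Divisibility.Signed as ℤ∣
import Data.Integer.Properties as ℤₚ
open import Data.Integer.Tactic.RingSolver using (solve-∀)
open import Data.List.Base using (List; []; _∷_; _++_; [_]; length; map; foldr; allFin)
open import Data.List.Membership.Propositional using (_∈_)
open import Data.List.Membership.Propositional.Properties using (∈-∃++; ∈-allFin)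
open import Data.List.Properties using (length-tabulate)
open import Data.List.Relation.Binary.Permutation.Propositional as ↭ using (_↭_; prep; swap; ↭-reflexive; ↭-trans; ↭-sym; ↭⇒↭ₛ)
open import Data.List.Relation.Binary.Permutation.Propositional.Properties using (∈-resp-↭; ↭-length; shift)
import Data.List.Relation.Binary.Permutation.Setoid.Properties as ↭ₛ
open import Data.List.Relation.Unary.All as All using (All; []; _∷_)
open import Data.List.Relation.Unary.AllPairs using (_∷_)
open import Data.List.Relation.Unary.Any using (here; there)
open import Data.List.Relation.Unary.Unique.Propositional using (Unique)
open import Data.List.Relation.Unary.Unique.Propositional.Properties using (allFin⁺)
open import Data.Nat.Base as ℕ using (ℕ; zero; suc; _<_; _≤_; _^_; z≤n; s≤s; s<s; NonZero)
open import Data.Nat.Coprimality using (coprime-Bézout; prime⇒coprime)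
open import Data.Nat.Divisibility as ℕ∣ using (_∣_)
open import Data.Nat.DivMod using (_%_; _/_; _mod_; m≡m%n+[m/n]*n; m%n<n)
open import Data.Nat.GCD using (module Bézout)
open import Data.Nat.Induction using (<-wellFounded; Acc; acc)
open import Data.Nat.ListAction using (product)
open import Data.Nat.Primality using (Prime; euclidsLemma; ¬prime[1])
open import Data.Nat.Primality.Factorisation using (PrimeFactorisation; factorise; factors)
import Data.Nat.Properties as ℕₚ
import Data.Nat.Tactic.RingSolver as ℕSolver
open import Data.Product.Base using (∃; _×_; _,_; proj₁; proj₂)
open import Data.Sum.Base as Sum using (_⊎_; inj₁; inj₂; [_,_]′)
open import Function.Base using (_∘_)
open import Relation.Binary.Bundles using (Setoid)
open import Relation.Binary.PropositionalEquality using (_≡_; _≢_; refl; sym; trans; cong; cong₂; subst; setoid; module ≡-Reasoning)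
import Relation.Binary.Reasoning.Setoid as SetoidReasoning
open import Relation.Nullary using (¬_; yes; no; contradiction)

-- Lists

module _ {A : Set} where

  -- Serves to split off a two-element orbit of an involution, or the two square roots of a residue.
  -- Once `x` is moved to the front, `x ≢ y` leaves `y` in the remainder, and uniqueness carries
  -- over along the permutation.
  remove-pair : ∀ {xs : List A} {x y} → Unique xs → x ∈ xs → y ∈ xs → x ≢ y →
                ∃ λ zs → xs ↭ x ∷ y ∷ zs × Unique (x ∷ y ∷ zs)
  remove-pair {xs} {x} {y} xs! x∈xs y∈xs x≢y with ∈-∃++ x∈xs
  ... | us , ws , refl with ∈-resp-↭ (shift x us ws) y∈xs
  ...   | here y≡x = contradiction (sym y≡x) x≢y
  ...   | there y∈ with ∈-∃++ y∈
  ...     | us′ , ws′ , eq = us′ ++ ws′ , perm , ↭ₛ.Unique-resp-↭ (setoid A) (↭⇒↭ₛ perm) xs!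
    where
    perm : us ++ [ x ] ++ ws ↭ x ∷ y ∷ us′ ++ ws′
    perm = ↭-trans (shift x us ws) (prep x (↭-trans (↭-reflexive eq) (shift y us′ ws′)))

  -- If `f z` were `x` or `y`, applying `f` again would bring `z` itself into the pair, which
  -- uniqueness forbids. The two disjunctions cover both a pair swapped by `f` and a pair of fixed
  -- points.
  remove-pair-invariant : ∀ {xs : List A} {x y zs} (f : A → A) → (∀ z → f (f z) ≡ z) →
    (∀ {z} → z ∈ xs → f z ∈ xs) → xs ↭ x ∷ y ∷ zs → Unique (x ∷ y ∷ zs) →
    f x ≡ x ⊎ f x ≡ y → f y ≡ x ⊎ f y ≡ y → ∀ {z} → z ∈ zs → f z ∈ zs
  remove-pair-invariant {x = x} {y} {zs} f inv closed perm ((_ ∷ x∉) ∷ y∉ ∷ _) fx fy {z} z∈zs =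
    go (∈-resp-↭ perm (closed (∈-resp-↭ (↭-sym perm) (there (there z∈zs)))))
    where
    not-pair : ∀ {w} → f z ≡ w → ¬ (f w ≡ x ⊎ f w ≡ y)
    not-pair refl (inj₁ e) = All.lookup x∉ z∈zs (trans (sym e) (inv z))
    not-pair refl (inj₂ e) = All.lookup y∉ z∈zs (trans (sym e) (inv z))
    go : f z ∈ x ∷ y ∷ zs → f z ∈ zs
    go (here fz≡x)           = contradiction fx (not-pair fz≡x)
    go (there (here fz≡y))   = contradiction fy (not-pair fz≡y)
    go (there (there fz∈zs)) = fz∈zs

-- Integers

^-distrib-* : ∀ a b k → (a ℤ.* b) ℤ.^ k ≡ a ℤ.^ k ℤ.* b ℤ.^ k
^-distrib-* a b zero = refl
^-distrib-* a b (suc k) = trans (cong (a ℤ.* b ℤ.*_) (^-distrib-* a b k)) (eq a b (a ℤ.^ k) (b ℤ.^ k))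
  where
  eq : ∀ a b c d → a ℤ.* b ℤ.* (c ℤ.* d) ≡ a ℤ.* c ℤ.* (b ℤ.* d)
  eq = solve-∀

^-double : ∀ a k → a ℤ.^ (k ℕ.+ k) ≡ (a ℤ.* a) ℤ.^ k
^-double a k = trans (ℤₚ.^-distribˡ-+-* a k k) (sym (^-distrib-* a a k))

-1^double : ∀ k → -1ℤ ℤ.^ (k ℕ.+ k) ≡ 1ℤ
-1^double k = trans (^-double -1ℤ k) (ℤₚ.^-zeroˡ k)

∣-1^k∣≤1 : ∀ k → ∣ -1ℤ ℤ.^ k ∣ ≤ 1
∣-1^k∣≤1 zero = ℕₚ.≤-refl
∣-1^k∣≤1 (suc k) rewrite ℤₚ.abs-* -1ℤ (-1ℤ ℤ.^ k) = ℕₚ.*-mono-≤ {1} {1} ℕₚ.≤-refl (∣-1^k∣≤1 k)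

prod : List ℤ → ℤ
prod = foldr ℤ._*_ 1ℤ

prod-map-↭ : ∀ {A : Set} (v : A → ℤ) {xs ys} → xs ↭ ys → prod (map v xs) ≡ prod (map v ys)
prod-map-↭ v ↭.refl = refl
prod-map-↭ v (prep x p) = cong (v x ℤ.*_) (prod-map-↭ v p)
prod-map-↭ v (swap x y p) = trans (eq (v x) (v y) _) (cong (λ c → v y ℤ.* (v x ℤ.* c)) (prod-map-↭ v p))
  where
  eq : ∀ a b c → a ℤ.* (b ℤ.* c) ≡ b ℤ.* (a ℤ.* c)
  eq = solve-∀
prod-map-↭ v (↭.trans p q) = trans (prod-map-↭ v p) (prod-map-↭ v q)

multiple-small⇒≡0 : ∀ {p z} → + p ℤ∣.∣ z → ∣ z ∣ < p → z ≡ 0ℤ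
multiple-small⇒≡0 {p} {z} p∣z z<p with ∣ z ∣ in eq | ℤ∣.∣⇒∣ᵤ p∣z
... | zero  | _   = ℤₚ.∣i∣≡0⇒i≡0 eq
... | suc _ | p∣k = contradiction p∣k (ℕ∣.>⇒∤ z<p)

double-injective : ∀ {j k} → j ℕ.+ j ≡ k ℕ.+ k → j ≡ k
double-injective {zero} {zero} _ = refl
double-injective {suc j} {suc k} eq =
  cong suc (double-injective (ℕₚ.suc-injective (trans (sym (ℕₚ.+-suc j j)) (trans (ℕₚ.suc-injective eq) (ℕₚ.+-suc k k)))))

even⊎odd : ∀ n → (∃ λ k → n ≡ k ℕ.+ k) ⊎ (∃ λ k → n ≡ suc (k ℕ.+ k))
even⊎odd zero = inj₁ (0 , refl)
even⊎odd (suc n) with even⊎odd n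
... | inj₁ (k , refl) = inj₂ (k , refl)
... | inj₂ (k , refl) = inj₁ (suc k , cong suc (sym (ℕₚ.+-suc k k)))

-- Congruence modulo p

module Congruence (p : ℕ) where

  infix 4 _≈_
  -- A record rather than a synonym, so that both sides can be inferred.
  record _≈_ (a b : ℤ) : Set where
    constructor congruent
    field divides-difference : + p ℤ∣.∣ a ℤ.- b
  open _≈_ public

  ≈-by : ∀ {a b c} → c ≡ a ℤ.- b → + p ℤ∣.∣ c → a ≈ b
  ≈-by refl = congruent

  ≈-reflexive : ∀ {a b} → a ≡ b → a ≈ b
  ≈-reflexive {a} refl = ≈-by (sym (ℤₚ.+-inverseʳ a)) (ℤ∣.divides 0ℤ refl)

  ≈-sym : ∀ {a b} → a ≈ b → b ≈ a
  ≈-sym {a} {b} (congruent d) = ≈-by (eq a b) (ℤ∣.∣m⇒∣-m d)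
    where
    eq : ∀ a b → - (a ℤ.- b) ≡ b ℤ.- a
    eq = solve-∀

  ≈-trans : ∀ {a b c} → a ≈ b → b ≈ c → a ≈ c
  ≈-trans {a} {b} {c} (congruent d) (congruent e) = ≈-by (eq a b c) (ℤ∣.∣m∣n⇒∣m+n d e)
    where
    eq : ∀ a b c → (a ℤ.- b) ℤ.+ (b ℤ.- c) ≡ a ℤ.- c
    eq = solve-∀

  ≈-setoid : Setoid _ _
  ≈-setoid = record
    { Carrier = ℤ ; _≈_ = _≈_
    ; isEquivalence = record { refl = ≈-reflexive refl ; sym = ≈-sym ; trans = ≈-trans } }

  *-cong : ∀ {a b c d} → a ≈ b → c ≈ d → a ℤ.* c ≈ b ℤ.* d
  *-cong {a} {b} {c} {d} (congruent u) (congruent v) =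
    ≈-by (eq a b c d) (ℤ∣.∣m∣n⇒∣m+n (ℤ∣.∣m⇒∣m*n c u) (ℤ∣.∣n⇒∣m*n b v))
    where
    eq : ∀ a b c d → (a ℤ.- b) ℤ.* c ℤ.+ b ℤ.* (c ℤ.- d) ≡ a ℤ.* c ℤ.- b ℤ.* d
    eq = solve-∀

  *-congˡ : ∀ a {b c} → b ≈ c → a ℤ.* b ≈ a ℤ.* c
  *-congˡ a = *-cong (≈-reflexive {a} refl)

  *-congʳ : ∀ c {a b} → a ≈ b → a ℤ.* c ≈ b ℤ.* c
  *-congʳ c a≈b = *-cong a≈b (≈-reflexive {c} refl)

  neg-cong : ∀ {a b} → a ≈ b → - a ≈ - b
  neg-cong {a} {b} a≈b = ≈-trans (≈-reflexive (sym (ℤₚ.-1*i≡-i a))) (≈-trans (*-congˡ -1ℤ a≈b) (≈-reflexive (ℤₚ.-1*i≡-i b)))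

  ^-cong : ∀ k {a b} → a ≈ b → a ℤ.^ k ≈ b ℤ.^ k
  ^-cong zero _ = ≈-reflexive refl
  ^-cong (suc k) a≈b = *-cong a≈b (^-cong k a≈b)

  ∣⇒≈0 : ∀ {a} → + p ℤ∣.∣ a → a ≈ 0ℤ
  ∣⇒≈0 {a} = ≈-by (sym (ℤₚ.+-identityʳ a))

  ≈0⇒∣ : ∀ {a} → a ≈ 0ℤ → + p ℤ∣.∣ a
  ≈0⇒∣ {a} (congruent d) = subst (+ p ℤ∣.∣_) (ℤₚ.+-identityʳ a) d

  ≈⇒≡ : ∀ {a b} → ∣ a ℤ.- b ∣ < p → a ≈ b → a ≡ b
  ≈⇒≡ {a} {b} small (congruent d) = ℤₚ.i-j≡0⇒i≡j a b (multiple-small⇒≡0 d small)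

  -- The two values differ by at most 2, which is less than `p`. This turns the congruence in
  -- Euler's criterion into equalities of symbols.
  ≈-sign⇒≡ : ∀ {a b} → 2 < p → ∣ a ∣ ≤ 1 → ∣ b ∣ ≤ 1 → a ≈ b → a ≡ b
  ≈-sign⇒≡ {a} {b} 2<p a≤1 b≤1 =
    ≈⇒≡ (ℕₚ.≤-<-trans (ℤₚ.∣i-j∣≤∣i∣+∣j∣ a b) (ℕₚ.≤-<-trans (ℕₚ.+-mono-≤ a≤1 b≤1) 2<p))

  module _ {A : Set} (v : A → ℤ) (a : ℤ) (f : A → A) (f-involutive : ∀ x → f (f x) ≡ x)
           (v-pair : ∀ x → v x ℤ.* v (f x) ≈ a) where

    -- Without fixed points, `xs` falls into orbits `{x, f x}`, each contributing a factor `a`. What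
    -- remains after removing an orbit is known only up to permutation, hence the recursion on the
    -- length.
    prod-pairing : ∀ xs → Unique xs → (∀ {x} → x ∈ xs → f x ∈ xs) → (∀ {x} → x ∈ xs → f x ≢ x) →
                   ∃ λ k → length xs ≡ k ℕ.+ k × prod (map v xs) ≈ a ℤ.^ k
    prod-pairing xs = go xs (<-wellFounded (length xs))
      where
      go : ∀ xs → Acc _<_ (length xs) → Unique xs →
           (∀ {x} → x ∈ xs → f x ∈ xs) → (∀ {x} → x ∈ xs → f x ≢ x) →
           ∃ λ k → length xs ≡ k ℕ.+ k × prod (map v xs) ≈ a ℤ.^ k
      go [] _ _ _ _ = 0 , refl , ≈-reflexive refl
      go (x ∷ xs) (acc rs) xs! closed free
        with remove-pair xs! (here refl) (closed (here refl)) (free (here refl) ∘ sym)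
      ... | zs , perm , u@(_ ∷ _ ∷ zs!)
        with go zs (rs (subst (length zs <_) (sym (↭-length perm)) (ℕₚ.n≤1+n _))) zs!
               (remove-pair-invariant f f-involutive closed perm u (inj₂ refl) (inj₁ (f-involutive x)))
               (λ z∈zs → free (∈-resp-↭ (↭-sym perm) (there (there z∈zs))))
      ... | k , len , eq = suc k
          , trans (↭-length perm) (cong suc (trans (cong suc len) (sym (ℕₚ.+-suc k k))))
          , (begin
               prod (map v (x ∷ xs))                     ≈⟨ ≈-reflexive (prod-map-↭ v perm) ⟩
               v x ℤ.* (v (f x) ℤ.* prod (map v zs))     ≈⟨ ≈-reflexive (sym (ℤₚ.*-assoc (v x) (v (f x)) _)) ⟩
               v x ℤ.* v (f x) ℤ.* prod (map v zs)       ≈⟨ *-cong (v-pair x) eq ⟩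
               a ℤ.^ suc k                               ∎)
        where open SetoidReasoning ≈-setoid

-- Euler's criterion

∣legendre∣≤1 : ∀ a p → ∣ legendre a p ∣ ≤ 1
∣legendre∣≤1 a p with + p ℤ∣.∣? a
... | yes _ = z≤n
... | no  _ with isSquareMod? p a
...   | yes _ = ℕₚ.≤-refl
...   | no  _ = ℕₚ.≤-refl

-- With `p` in this form, `h` is the exponent (p - 1)/2 of Euler's criterion, and `h + h` is the
-- number of nonzero residues.
module OddPrime (h : ℕ) (p-prime : Prime (suc (h ℕ.+ h))) where

  p : ℕ
  p = suc (h ℕ.+ h)

  open Congruence p
  open SetoidReasoning ≈-setoid

  2<p : 2 < p
  2<p = go h p-prime
    where
    go : ∀ h → Prime (suc (h ℕ.+ h)) → 2 < suc (h ℕ.+ h)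
    go zero    pr = contradiction pr ¬prime[1]
    go (suc h) _  = s≤s (s≤s (subst (1 ≤_) (sym (ℕₚ.+-suc h h)) (s≤s z≤n)))

  integral : ∀ a b → a ℤ.* b ≈ 0ℤ → a ≈ 0ℤ ⊎ b ≈ 0ℤ
  integral a b ab≈0 with euclidsLemma ∣ a ∣ ∣ b ∣ p-prime
                           (subst (p ∣_) (ℤₚ.abs-* a b) (ℤ∣.∣⇒∣ᵤ (≈0⇒∣ ab≈0)))
  ... | inj₁ p∣a = inj₁ (∣⇒≈0 (ℤ∣.∣ᵤ⇒∣ p∣a))
  ... | inj₂ p∣b = inj₂ (∣⇒≈0 (ℤ∣.∣ᵤ⇒∣ p∣b))

  cancelˡ : ∀ c {a b} → ¬ c ≈ 0ℤ → c ℤ.* a ≈ c ℤ.* b → a ≈ b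
  cancelˡ c {a} {b} c≉0 (congruent d) =
    [ (λ c≈0 → contradiction c≈0 c≉0) , (λ a-b≈0 → congruent (≈0⇒∣ a-b≈0)) ]′
      (integral c (a ℤ.- b) (∣⇒≈0 (subst (+ p ℤ∣.∣_) (eq c a b) d)))
    where
    eq : ∀ c a b → c ℤ.* a ℤ.- c ℤ.* b ≡ c ℤ.* (a ℤ.- b)
    eq = solve-∀

  squares-equal : ∀ a b → a ℤ.* a ≈ b ℤ.* b → a ≈ b ⊎ a ≈ - b
  squares-equal a b (congruent d) =
    Sum.map (λ e → congruent (≈0⇒∣ e)) (λ e → congruent (≈0⇒∣ e))
      (integral (a ℤ.- b) (a ℤ.- (- b)) (∣⇒≈0 (subst (+ p ℤ∣.∣_) (eq a b) d)))
    where
    eq : ∀ a b → a ℤ.* a ℤ.- b ℤ.* b ≡ (a ℤ.- b) ℤ.* (a ℤ.- (- b))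
    eq = solve-∀

  -- The difference is `2a`, and 2 is nonzero modulo an odd prime. This keeps the square roots `b`
  -- and `- b` apart.
  ≉-neg : ∀ {a} → ¬ a ≈ 0ℤ → ¬ a ≈ - a
  ≉-neg {a} a≉0 (congruent d) =
    [ (λ 2≈0 → contradiction (ℤ∣.∣⇒∣ᵤ (≈0⇒∣ 2≈0)) (ℕ∣.>⇒∤ 2<p)) , a≉0 ]′
      (integral (+ 2) a (∣⇒≈0 (subst (+ p ℤ∣.∣_) (eq a) d)))
    where
    eq : ∀ a → a ℤ.- (- a) ≡ + 2 ℤ.* a
    eq = solve-∀

  Unit : Set
  Unit = Fin (h ℕ.+ h)

  -- The shift by one skips the zero residue, so no proof of being nonzero has to accompany a
  -- `Unit`.
  val : Unit → ℤ
  val x = + suc (toℕ x)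

  val≉0 : ∀ x → ¬ val x ≈ 0ℤ
  val≉0 x e = contradiction (ℤ∣.∣⇒∣ᵤ (≈0⇒∣ e)) (ℕ∣.>⇒∤ (s<s (toℕ<n x)))

  val-injective : ∀ {x y} → val x ≈ val y → x ≡ y
  val-injective {x} {y} e = toℕ-injective (ℕₚ.suc-injective (ℤₚ.+-injective (≈⇒≡ small e)))
    where
    small : ∣ val x ℤ.- val y ∣ < p
    small = ℕₚ.≤-<-trans (ℤₚ.∣m⊝n∣≤m⊔n (suc (toℕ x)) (suc (toℕ y)))
              (ℕₚ.⊔-lub (s<s (toℕ<n x)) (s<s (toℕ<n y)))

  val-surjective : ∀ z → ¬ z ≈ 0ℤ → ∃ λ x → val x ≈ z
  val-surjective z z≉0 with z %ℕ p | ℤDivMod.n%ℕd<d z p | ℤDivMod.a≡a%ℕn+[a/ℕn]*n z p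
  ... | zero  | _       | eq = contradiction (∣⇒≈0 (ℤ∣.divides (z /ℕ p) (trans eq (ℤₚ.+-identityˡ _)))) z≉0
  ... | suc r | s<s r<q | eq = fromℕ< r<q , ≈-sym (≈-by
      (trans (e (+ suc r) (z /ℕ p ℤ.* + p)) (cong₂ ℤ._-_ (sym eq) (cong (λ k → + suc k) (sym (toℕ-fromℕ< r<q)))))
      (ℤ∣.divides (z /ℕ p) refl))
    where
    e : ∀ r s → s ≡ r ℤ.+ s ℤ.- r
    e = solve-∀

  inverse : ∀ x → ∃ λ y → val x ℤ.* y ≈ 1ℤ
  inverse x with coprime-Bézout (prime⇒coprime p-prime (s<s (toℕ<n x)))
  -- Bézout over ℕ comes in two forms. Here `s p = 1 + t x`, so the inverse is `- t`; in the other
  -- case `1 + s p = t x`, so it is `t`.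
  ... | Bézout.+- s t eq = - + t , ≈-by (trans (cong (λ c → - c) lift) (e (+ t) (val x))) (ℤ∣.∣m⇒∣-m (ℤ∣.divides (+ s) refl))
    where
    lift : + s ℤ.* + p ≡ 1ℤ ℤ.+ + t ℤ.* val x
    lift = trans (sym (ℤₚ.pos-* s p)) (trans (cong +_ (sym eq))
             (trans (ℤₚ.pos-+ 1 (t ℕ.* suc (toℕ x))) (cong (λ c → 1ℤ ℤ.+ c) (ℤₚ.pos-* t (suc (toℕ x))))))
    e : ∀ t x → - (1ℤ ℤ.+ t ℤ.* x) ≡ x ℤ.* (- t) ℤ.- 1ℤ
    e = solve-∀
  ... | Bézout.-+ s t eq = + t , ≈-by (trans (e (+ s ℤ.* + p)) (trans (cong (ℤ._- 1ℤ) lift) (cong (ℤ._- 1ℤ) (ℤₚ.*-comm (+ t) (val x))))) (ℤ∣.divides (+ s) refl)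
    where
    lift : 1ℤ ℤ.+ + s ℤ.* + p ≡ + t ℤ.* val x
    lift = trans (cong (λ c → 1ℤ ℤ.+ c) (sym (ℤₚ.pos-* s p))) (trans (sym (ℤₚ.pos-+ 1 (s ℕ.* p)))
             (trans (cong +_ eq) (ℤₚ.pos-* t (suc (toℕ x)))))
    e : ∀ s → s ≡ 1ℤ ℤ.+ s ℤ.- 1ℤ
    e = solve-∀

  units : List Unit
  units = allFin (h ℕ.+ h)

  length-units : length units ≡ h ℕ.+ h
  length-units = length-tabulate {n = h ℕ.+ h} (λ x → x)

  module _ {a : ℤ} (a≉0 : ¬ a ≈ 0ℤ) where

    divide : ∀ x i → val x ℤ.* i ≈ 1ℤ → val x ℤ.* (i ℤ.* a) ≈ a
    divide x i xi≈1 = begin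
      val x ℤ.* (i ℤ.* a)  ≈⟨ ≈-reflexive (sym (ℤₚ.*-assoc (val x) i a)) ⟩
      val x ℤ.* i ℤ.* a    ≈⟨ *-congʳ a xi≈1 ⟩
      1ℤ ℤ.* a             ≈⟨ ≈-reflexive (ℤₚ.*-identityˡ a) ⟩
      a                    ∎

    -- Abstract because unfolding the Bézout computation makes type checking diverge in practice.
    abstract
      quotient : ∀ x → ∃ λ y → val x ℤ.* val y ≈ a
      quotient x =
        let i , xi≈1 = inverse x
            xia≈a    = divide x i xi≈1
            ia≉0     = λ ia≈0 → a≉0 (≈-trans (≈-sym xia≈a)
                         (≈-trans (*-congˡ (val x) ia≈0) (≈-reflexive (ℤₚ.*-zeroʳ (val x)))))
            y , y≈ia = val-surjective (i ℤ.* a) ia≉0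
        in y , ≈-trans (*-congˡ (val x) y≈ia) xia≈a

    partner : Unit → Unit
    partner x = proj₁ (quotient x)

    val-partner : ∀ x → val x ℤ.* val (partner x) ≈ a
    val-partner x = proj₂ (quotient x)

    partner-unique : ∀ {x y} → val x ℤ.* val y ≈ a → partner x ≡ y
    partner-unique {x} e = val-injective (cancelˡ (val x) (val≉0 x) (≈-trans (val-partner x) (≈-sym e)))

    partner-involutive : ∀ x → partner (partner x) ≡ x
    partner-involutive x = partner-unique
      (≈-trans (≈-reflexive (ℤₚ.*-comm (val (partner x)) (val x))) (val-partner x))

    prod-units-nonsquare : (∀ x → ¬ val x ℤ.* val x ≈ a) → prod (map val units) ≈ a ℤ.^ h
    prod-units-nonsquare nonsquare =
      let k , len , eq = prod-pairing val a partner partner-involutive val-partner units (allFin⁺ _)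
            (λ _ → ∈-allFin _)
            -- A fixed point of `partner` would be a square root of `a`.
            (λ {x} _ e → nonsquare x (subst (λ y → val x ℤ.* val y ≈ a) e (val-partner x)))
      in subst (λ j → prod (map val units) ≈ a ℤ.^ j) (double-injective {k} {h} (trans (sym len) length-units)) eq

    -- The fixed points of `partner` are `b` and `- b`, with product `- a`. The other residues form
    -- `h - 1` pairs of product `a`.
    prod-units-square : ∀ b → val b ℤ.* val b ≈ a → prod (map val units) ≈ - (a ℤ.^ h)
    prod-units-square b b²≈a =
      let c , c≈-b        = val-surjective (- val b) -b≉0
          zs , perm , zs! = remove-pair (allFin⁺ _) (∈-allFin b) (∈-allFin c)
                              (λ b≡c → ≉-neg (val≉0 b) (subst (λ x → val x ≈ - val b) (sym b≡c) c≈-b))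
      in without-roots c c≈-b zs perm zs!
      where
      -b≉0 : ¬ - val b ≈ 0ℤ
      -b≉0 e = val≉0 b (≈-trans (≈-reflexive (sym (ℤₚ.neg-involutive (val b)))) (neg-cong e))

      neg² : ∀ b → (- b) ℤ.* (- b) ≡ b ℤ.* b
      neg² = solve-∀

      rearrange : ∀ b c → b ℤ.* ((- b) ℤ.* c) ≡ - (b ℤ.* b ℤ.* c)
      rearrange = solve-∀

      without-roots : ∀ c → val c ≈ - val b → ∀ zs → units ↭ b ∷ c ∷ zs → Unique (b ∷ c ∷ zs) →
                      prod (map val units) ≈ - (a ℤ.^ h)
      without-roots c c≈-b zs perm u@((_ ∷ b∉zs) ∷ c∉zs ∷ zs!) =
        let k , len , eq = prod-pairing val a partner partner-involutive val-partner zs zs! closed free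
        in begin
          prod (map val units)                          ≈⟨ ≈-reflexive (prod-map-↭ val perm) ⟩
          val b ℤ.* (val c ℤ.* prod (map val zs))       ≈⟨ *-congˡ (val b) (*-cong c≈-b eq) ⟩
          val b ℤ.* ((- val b) ℤ.* a ℤ.^ k)             ≈⟨ ≈-reflexive (rearrange (val b) (a ℤ.^ k)) ⟩
          - (val b ℤ.* val b ℤ.* a ℤ.^ k)               ≈⟨ neg-cong (*-congʳ (a ℤ.^ k) b²≈a) ⟩
          - (a ℤ.^ suc k)                               ≈⟨ ≈-reflexive (cong (λ j → - (a ℤ.^ j)) (suc-k≡h k len)) ⟩
          - (a ℤ.^ h)                                   ∎
        where
        c²≈a : val c ℤ.* val c ≈ a
        c²≈a = ≈-trans (*-cong c≈-b c≈-b) (≈-trans (≈-reflexive (neg² (val b))) b²≈a)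

        closed : ∀ {z} → z ∈ zs → partner z ∈ zs
        closed = remove-pair-invariant partner partner-involutive (λ _ → ∈-allFin _) perm u
                   (inj₁ (partner-unique b²≈a)) (inj₂ (partner-unique c²≈a))

        -- A fixed point `z` satisfies `z² ≈ a ≈ b²`, so it is one of the two roots already removed.
        free : ∀ {z} → z ∈ zs → partner z ≢ z
        free {z} z∈zs e =
          [ (λ z≈b → All.lookup b∉zs z∈zs (sym (val-injective z≈b)))
          , (λ z≈-b → All.lookup c∉zs z∈zs (val-injective (≈-trans c≈-b (≈-sym z≈-b)))) ]′
            (squares-equal (val z) (val b)
              (≈-trans (subst (λ y → val z ℤ.* val y ≈ a) e (val-partner z)) (≈-sym b²≈a)))

        -- The two removed roots account for the missing pair: `2 + 2k = 2h`.
        suc-k≡h : ∀ k → length zs ≡ k ℕ.+ k → suc k ≡ h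
        suc-k≡h k len = double-injective (trans (cong suc (ℕₚ.+-suc k k)) (trans (cong (suc ∘ suc) (sym len))
                          (trans (sym (↭-length perm)) length-units)))

  1≉0 : ¬ 1ℤ ≈ 0ℤ
  1≉0 e = contradiction (ℤ∣.∣⇒∣ᵤ (≈0⇒∣ e)) (ℕ∣.>⇒∤ (ℕₚ.<-trans ℕₚ.≤-refl 2<p))

  -- The case `a = 1` of the square count, with 1 as its own root.
  wilson : prod (map val units) ≈ -1ℤ
  wilson =
    let b , b≈1 = val-surjective 1ℤ 1≉0
    in ≈-trans (prod-units-square 1≉0 b (*-cong b≈1 b≈1)) (≈-reflexive (cong (λ c → - c) (ℤₚ.^-zeroˡ h)))

  0^h≡0 : 0ℤ ℤ.^ h ≡ 0ℤ
  0^h≡0 = go h p-prime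
    where
    go : ∀ h → Prime (suc (h ℕ.+ h)) → 0ℤ ℤ.^ h ≡ 0ℤ
    go zero    pr = contradiction pr ¬prime[1]
    go (suc h) _  = refl

  -- The product of all nonzero residues is -1 by `wilson`, and it is also `a ^ h` or `- (a ^ h)`
  -- according to whether `a` is a nonsquare or a nonzero square.
  euler-criterion : ∀ a → legendre a p ≈ a ℤ.^ h
  euler-criterion a with + p ℤ∣.∣? a
  ... | yes p∣a = ≈-sym (≈-trans (^-cong h (∣⇒≈0 p∣a)) (≈-reflexive 0^h≡0))
  ... | no  p∤a with isSquareMod? p a
  ...   | no ¬square = ≈-trans (≈-sym wilson) (prod-units-nonsquare (p∤a ∘ ≈0⇒∣)
            -- `val x` is by definition the integer of `Fin.suc x`, which lies in `Fin p` as
            -- `IsSquareMod` demands.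
            (λ x e → ¬square (Fin.suc x , divides-difference e)))
  ...   | yes (x , d) =
            let b , b≈x = val-surjective (+ toℕ x)
                  -- The root is nonzero, since otherwise `a ≈ x²` would vanish modulo `p`.
                  (λ e → p∤a (≈0⇒∣ (≈-trans (≈-sym (congruent d)) (*-cong e e))))
            in begin
              1ℤ                      ≈⟨ neg-cong (≈-sym wilson) ⟩
              - prod (map val units)  ≈⟨ neg-cong (prod-units-square (p∤a ∘ ≈0⇒∣) b
                                           (≈-trans (*-cong b≈x b≈x) (congruent d))) ⟩
              - - (a ℤ.^ h)           ≈⟨ ≈-reflexive (ℤₚ.neg-involutive (a ℤ.^ h)) ⟩
              a ℤ.^ h                 ∎

  legendre-* : ∀ a b → legendre (a ℤ.* b) p ≡ legendre a p ℤ.* legendre b p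
  legendre-* a b = ≈-sign⇒≡ 2<p (∣legendre∣≤1 (a ℤ.* b) p)
    (subst (_≤ 1) (sym (ℤₚ.abs-* (legendre a p) (legendre b p))) (ℕₚ.*-mono-≤ (∣legendre∣≤1 a p) (∣legendre∣≤1 b p)))
    (begin
      legendre (a ℤ.* b) p              ≈⟨ euler-criterion (a ℤ.* b) ⟩
      (a ℤ.* b) ℤ.^ h                   ≈⟨ ≈-reflexive (^-distrib-* a b h) ⟩
      a ℤ.^ h ℤ.* b ℤ.^ h               ≈⟨ ≈-sym (*-cong (euler-criterion a) (euler-criterion b)) ⟩
      legendre a p ℤ.* legendre b p     ∎)

  -- For `h = 2k`, Euler's criterion gives `a ^ h = (a²) ^ k ≈ (-1) ^ k`. For odd `h`, the square of
  -- the symbol would be congruent to `(-1) ^ h = -1`, hence equal to it, which no integer square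
  -- is.
  legendre-√-1 : ∀ a → a ℤ.* a ≈ -1ℤ → ∃ λ k → p ≡ suc (4 ℕ.* k) × legendre a p ≡ -1ℤ ℤ.^ k
  legendre-√-1 a a²≈-1 with even⊎odd h
  ... | inj₁ (k , h≡k+k) = k , trans (cong (λ j → suc (j ℕ.+ j)) h≡k+k) (four k)
      , ≈-sign⇒≡ 2<p (∣legendre∣≤1 a p) (∣-1^k∣≤1 k) (begin
          legendre a p       ≈⟨ euler-criterion a ⟩
          a ℤ.^ h            ≈⟨ ≈-reflexive (trans (cong (a ℤ.^_) h≡k+k) (^-double a k)) ⟩
          (a ℤ.* a) ℤ.^ k    ≈⟨ ^-cong k a²≈-1 ⟩
          -1ℤ ℤ.^ k          ∎)
    where
    four : ∀ k → suc (k ℕ.+ k ℕ.+ (k ℕ.+ k)) ≡ suc (4 ℕ.* k)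
    four = ℕSolver.solve-∀
  ... | inj₂ (k , h≡1+k+k) = contradiction L²≡-1 (square≢-1 L)
    where
    L = legendre a p
    L²≡-1 : L ℤ.* L ≡ -1ℤ
    L²≡-1 = ≈-sign⇒≡ 2<p
      (subst (_≤ 1) (sym (ℤₚ.abs-* L L)) (ℕₚ.*-mono-≤ (∣legendre∣≤1 a p) (∣legendre∣≤1 a p))) ℕₚ.≤-refl (begin
        L ℤ.* L                ≈⟨ *-cong (euler-criterion a) (euler-criterion a) ⟩
        a ℤ.^ h ℤ.* a ℤ.^ h    ≈⟨ ≈-reflexive (sym (^-distrib-* a a h)) ⟩
        (a ℤ.* a) ℤ.^ h        ≈⟨ ^-cong h a²≈-1 ⟩
        -1ℤ ℤ.^ h              ≈⟨ ≈-reflexive (trans (cong (-1ℤ ℤ.^_) h≡1+k+k) (cong (-1ℤ ℤ.*_) (-1^double k))) ⟩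
        -1ℤ                    ∎)
    square≢-1 : ∀ z → z ℤ.* z ≢ -1ℤ
    square≢-1 (+ zero) ()
    square≢-1 (+ suc _) ()
    square≢-1 (ℤ.-[1+ _ ]) ()

-- Jacobi symbols

IsOddPrime : ℕ → Set
IsOddPrime p = Prime p × ¬ 2 ∣ p

halve : ∀ {p} → ¬ 2 ∣ p → ∃ λ h → p ≡ suc (h ℕ.+ h)
halve {p} 2∤p with even⊎odd p
... | inj₁ (k , refl) = contradiction (ℕ∣.divides k (eq k)) 2∤p
  where
  eq : ∀ k → k ℕ.+ k ≡ k ℕ.* 2
  eq = ℕSolver.solve-∀
... | inj₂ r = r

legendre-prod-* : ∀ a b {ps} → All IsOddPrime ps →
  prod (map (legendre (a ℤ.* b)) ps) ≡ prod (map (legendre a) ps) ℤ.* prod (map (legendre b) ps)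
legendre-prod-* a b [] = refl
legendre-prod-* a b {p ∷ ps} ((p-prime , 2∤p) ∷ rest) with halve 2∤p
... | h , refl = trans (cong₂ ℤ._*_ (OddPrime.legendre-* h p-prime a b) (legendre-prod-* a b rest))
                   (eq (legendre a p) (legendre b p) _ _)
  where
  eq : ∀ a b c d → a ℤ.* b ℤ.* (c ℤ.* d) ≡ a ℤ.* c ℤ.* (b ℤ.* d)
  eq = solve-∀

-- Each prime factor divides `a² + 1`, so `legendre-√-1` applies to it. The exponents combine by (4k
-- + 1)(4l + 1) = 4(k + l + 4kl) + 1, where 4kl is even and does not affect the sign.
legendre-prod-√-1 : ∀ a {ps} → All IsOddPrime ps → + product ps ℤ∣.∣ a ℤ.* a ℤ.- -1ℤ →
  ∃ λ k → product ps ≡ suc (4 ℕ.* k) × prod (map (legendre a) ps) ≡ -1ℤ ℤ.^ k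
legendre-prod-√-1 a [] _ = 0 , refl , refl
legendre-prod-√-1 a {p ∷ ps} ((p-prime , 2∤p) ∷ rest) d with halve 2∤p
... | h , refl
  with OddPrime.legendre-√-1 h p-prime a (Congruence.congruent (ℤ∣.∣-trans (ℤ∣.∣ᵤ⇒∣ (ℕ∣.m∣m*n (product ps))) d))
     | legendre-prod-√-1 a rest (ℤ∣.∣-trans (ℤ∣.∣ᵤ⇒∣ (ℕ∣.n∣m*n p)) d)
... | k , p≡ , legendre≡ | l , ps≡ , prod≡ =
    -- The term 4kl is written `j + j`, so that `-1^double` removes it from the exponent.
    k ℕ.+ (l ℕ.+ (j ℕ.+ j))
  , trans (cong₂ ℕ._*_ p≡ ps≡) (eq k l)
  , trans (cong₂ ℤ._*_ legendre≡ prod≡) (sym (trans (ℤₚ.^-distribˡ-+-* -1ℤ k _)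
      (cong (-1ℤ ℤ.^ k ℤ.*_) (trans (ℤₚ.^-distribˡ-+-* -1ℤ l _)
        (trans (cong (-1ℤ ℤ.^ l ℤ.*_) (-1^double j)) (ℤₚ.*-identityʳ _))))))
  where
  j = 2 ℕ.* k ℕ.* l
  eq : ∀ k l → suc (4 ℕ.* k) ℕ.* suc (4 ℕ.* l) ≡ suc (4 ℕ.* (k ℕ.+ (l ℕ.+ (2 ℕ.* k ℕ.* l ℕ.+ 2 ℕ.* k ℕ.* l))))
  eq = ℕSolver.solve-∀

All-∣-product : ∀ ps → All (_∣ product ps) ps
All-∣-product [] = []
All-∣-product (p ∷ ps) = ℕ∣.m∣m*n (product ps) ∷ All.map (λ q∣ → ℕ∣.∣-trans q∣ (ℕ∣.n∣m*n p)) (All-∣-product ps)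

odd-factors : ∀ m .{{_ : NonZero m}} → ¬ 2 ∣ m → All IsOddPrime (factors (factorise m))
odd-factors m 2∤m = All.zipWith (λ (pr , p∣) → pr , λ 2∣p → 2∤m (subst (2 ∣_) (sym isFactorisation) (ℕ∣.∣-trans 2∣p p∣)))
    (factorsPrime , All-∣-product _)
  where open PrimeFactorisation (factorise m)

jacobi-* : ∀ m .{{_ : NonZero m}} → ¬ 2 ∣ m → ∀ a b → jacobi (a ℤ.* b) m ≡ jacobi a m ℤ.* jacobi b m
jacobi-* m 2∤m a b = legendre-prod-* a b (odd-factors m 2∤m)

-- Since `k` is forced to be (m - 1)/4, the symbol of a square root of -1 depends on `m` alone.
jacobi-√-1 : ∀ m .{{_ : NonZero m}} → ¬ 2 ∣ m → ∀ a → + m ℤ∣.∣ a ℤ.* a ℤ.- -1ℤ →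
             ∃ λ k → m ≡ suc (4 ℕ.* k) × jacobi a m ≡ -1ℤ ℤ.^ k
jacobi-√-1 m 2∤m a d with legendre-prod-√-1 a (odd-factors m 2∤m) (subst (λ k → + k ℤ∣.∣ a ℤ.* a ℤ.- -1ℤ) (PrimeFactorisation.isFactorisation (factorise m)) d)
... | k , m≡ , eq = k , trans (PrimeFactorisation.isFactorisation (factorise m)) m≡ , eq

-- The matrix Q n

2∤1+n² : ∀ {n} → 2 ∣ n → ¬ 2 ∣ suc (n ^ 2)
2∤1+n² {n} 2∣n 2∣m with ℕ∣.∣1⇒≡1 (ℕ∣.∣m+n∣m⇒∣n (subst (2 ∣_) (ℕₚ.+-comm 1 (n ^ 2)) 2∣m) (ℕ∣.∣-trans 2∣n (ℕ∣.m∣m*n (n ^ 1))))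
... | ()

1+n²≡ : ∀ n → + suc (n ^ 2) ≡ 1ℤ ℤ.+ + n ℤ.* + n
1+n²≡ n = trans (ℤₚ.pos-+ 1 (n ^ 2)) (cong (λ c → 1ℤ ℤ.+ c) (trans (cong (λ k → + (n ℕ.* k)) (ℕₚ.*-identityʳ n)) (ℤₚ.pos-* n n)))

jacobi-n : ∀ n → 2 ∣ n → ∃ λ k → n ^ 2 ≡ 4 ℕ.* k × jacobi (+ n) (suc (n ^ 2)) ≡ -1ℤ ℤ.^ k
jacobi-n n 2∣n with jacobi-√-1 (suc (n ^ 2)) (2∤1+n² 2∣n) (+ n)
    -- `n² - (-1)` is the modulus itself, hence the quotient 1.
    (ℤ∣.divides 1ℤ (trans (ℤₚ.+-comm (+ n ℤ.* + n) 1ℤ) (trans (sym (1+n²≡ n)) (sym (ℤₚ.*-identityˡ _)))))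
... | k , m≡ , eq = k , ℕₚ.suc-injective m≡ , eq

jacobi-n≡1 : ∀ n → 2 ∣ n → n % 4 ≡ 0 → jacobi (+ n) (suc (n ^ 2)) ≡ 1ℤ
jacobi-n≡1 n 2∣n n%4≡0 with jacobi-n n 2∣n
... | k , n²≡4k , eq = trans eq (trans (cong (-1ℤ ℤ.^_) (ℕₚ.*-cancelˡ-≡ k (j ℕ.+ j) 4
      (trans (sym n²≡4k) (trans (cong (_^ 2) n≡) (square q))))) (-1^double j))
  where
  q = n / 4
  -- For `n = 4q`, the exponent n²/4 is `4q² = j + j`.
  j = 2 ℕ.* q ℕ.* q
  n≡ : n ≡ q ℕ.* 4
  n≡ = trans (m≡m%n+[m/n]*n n 4) (cong (ℕ._+ q ℕ.* 4) n%4≡0)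
  square : ∀ q → (q ℕ.* 4) ℕ.* ((q ℕ.* 4) ℕ.* 1) ≡ 4 ℕ.* (2 ℕ.* q ℕ.* q ℕ.+ 2 ℕ.* q ℕ.* q)
  square = ℕSolver.solve-∀

jacobi-n≡-1 : ∀ n → 2 ∣ n → n % 4 ≡ 2 → jacobi (+ n) (suc (n ^ 2)) ≡ -1ℤ
jacobi-n≡-1 n 2∣n n%4≡2 with jacobi-n n 2∣n
... | k , n²≡4k , eq = trans eq (trans (cong (-1ℤ ℤ.^_) (ℕₚ.*-cancelˡ-≡ k (suc (j ℕ.+ j)) 4
      (trans (sym n²≡4k) (trans (cong (_^ 2) n≡) (square q))))) (cong (-1ℤ ℤ.*_) (-1^double j)))
  where
  q = n / 4
  -- For `n = 4q + 2`, the exponent n²/4 is `(2q + 1)² = 1 + (j + j)`.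
  j = 2 ℕ.* q ℕ.+ 2 ℕ.* q ℕ.* q
  n≡ : n ≡ 2 ℕ.+ q ℕ.* 4
  n≡ = trans (m≡m%n+[m/n]*n n 4) (cong (ℕ._+ q ℕ.* 4) n%4≡2)
  square : ∀ q → (2 ℕ.+ q ℕ.* 4) ℕ.* ((2 ℕ.+ q ℕ.* 4) ℕ.* 1) ≡ 4 ℕ.* suc ((2 ℕ.* q ℕ.+ 2 ℕ.* q ℕ.* q) ℕ.+ (2 ℕ.* q ℕ.+ 2 ℕ.* q ℕ.* q))
  square = ℕSolver.solve-∀

jacobi/-mod : ∀ m .{{_ : NonZero m}} a → jacobi/ m (a mod m) ≡ jacobi (+ a) m
jacobi/-mod m a = sym (jacobi-cong m (+ a) (+ toℕ (a mod m)) (ℤ∣.divides (+ (a / m))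
    (trans (cong₂ ℤ._-_ a≡ (cong +_ (toℕ-fromℕ< (m%n<n a m)))) (eq (+ (a % m)) _))))
  where
  a≡ : + a ≡ + (a % m) ℤ.+ + (a / m) ℤ.* + m
  a≡ = trans (cong +_ (m≡m%n+[m/n]*n a m)) (trans (ℤₚ.pos-+ (a % m) _) (cong (λ c → + (a % m) ℤ.+ c) (ℤₚ.pos-* (a / m) m)))
  eq : ∀ r s → r ℤ.+ s ℤ.- r ≡ s
  eq = solve-∀

-- In 0-based indices, `(n - i) + j n - n (1 + j + i n) = - i (1 +
-- n²)`. So rotation is multiplication by `n` modulo `n² + 1`, with quotient `- i`.
rotated-entry : ∀ n (i j : Fin n) →
  + suc (n ^ 2) ℤ∣.∣ + (suc (toℕ (opposite i)) ℕ.+ toℕ j ℕ.* n) ℤ.- + n ℤ.* + (suc (toℕ j) ℕ.+ toℕ i ℕ.* n)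
rotated-entry n i j = ℤ∣.divides (- + toℕ i) (begin
    + (suc o ℕ.+ toℕ j ℕ.* n) ℤ.- + n ℤ.* + (suc (toℕ j) ℕ.+ toℕ i ℕ.* n)
      ≡⟨ cong₂ (λ a b → a ℤ.- + n ℤ.* b) (entry o (toℕ j)) (entry (toℕ j) (toℕ i)) ⟩
    (1ℤ ℤ.+ + o ℤ.+ J ℤ.* N) ℤ.- N ℤ.* (1ℤ ℤ.+ J ℤ.+ I ℤ.* N)
      ≡⟨ cong (λ z → z ℤ.+ J ℤ.* N ℤ.- N ℤ.* (1ℤ ℤ.+ J ℤ.+ I ℤ.* N)) 1+o≡n-i ⟩
    ((N ℤ.- I) ℤ.+ J ℤ.* N) ℤ.- N ℤ.* (1ℤ ℤ.+ J ℤ.+ I ℤ.* N)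
      ≡⟨ identity N I J ⟩
    (- I) ℤ.* (1ℤ ℤ.+ N ℤ.* N)
      ≡⟨ cong ((- I) ℤ.*_) (sym (1+n²≡ n)) ⟩
    (- I) ℤ.* + suc (n ^ 2) ∎)
  where
  open ≡-Reasoning
  o = toℕ (opposite i)
  N = + n
  I = + toℕ i
  J = + toℕ j
  entry : ∀ a b → + (suc a ℕ.+ b ℕ.* n) ≡ 1ℤ ℤ.+ + a ℤ.+ + b ℤ.* + n
  entry a b = trans (ℤₚ.pos-+ (suc a) (b ℕ.* n)) (cong₂ ℤ._+_ (ℤₚ.pos-+ 1 a) (ℤₚ.pos-* b n))
  rotate : ∀ o i → 1ℤ ℤ.+ o ≡ o ℤ.+ (1ℤ ℤ.+ i) ℤ.- i
  rotate = solve-∀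
  -- `opposite i` is `n ∸ suc i` in 0-based form; the subtraction does not truncate because
  -- `toℕ i < n`.
  1+o≡n-i : 1ℤ ℤ.+ + o ≡ N ℤ.- I
  1+o≡n-i = trans (rotate (+ o) I) (cong (ℤ._- I) (trans (sym (ℤₚ.pos-+ o (suc (toℕ i))))
    (cong +_ (trans (cong (ℕ._+ suc (toℕ i)) (opposite-prop i)) (ℕₚ.m∸n+n≡m (toℕ<n i))))))
  identity : ∀ n i j → ((n ℤ.- i) ℤ.+ j ℤ.* n) ℤ.- n ℤ.* (1ℤ ℤ.+ j ℤ.+ i ℤ.* n) ≡ (- i) ℤ.* (1ℤ ℤ.+ n ℤ.* n)
  identity = solve-∀

-- Multiplicativity of the symbol pulls out the factor `n`; the evenness of `n` makes the modulus
-- odd, as `jacobi-*` requires.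
jacobi-rotated : ∀ n → 2 ∣ n → ∀ i j → let m = suc (n ^ 2) in
  jacobiMatrix m (ρ (Q n)) i j ≡ jacobi (+ n) m ℤ.* jacobiMatrix m (Q n) i j
jacobi-rotated n 2∣n i j = begin
    jacobi/ m (b mod m)               ≡⟨ jacobi/-mod m b ⟩
    jacobi (+ b) m                    ≡⟨ jacobi-cong m (+ b) (+ n ℤ.* + a) (rotated-entry n i j) ⟩
    jacobi (+ n ℤ.* + a) m            ≡⟨ jacobi-* m (2∤1+n² 2∣n) (+ n) (+ a) ⟩
    jacobi (+ n) m ℤ.* jacobi (+ a) m ≡⟨ cong (jacobi (+ n) m ℤ.*_) (sym (jacobi/-mod m a)) ⟩
    jacobi (+ n) m ℤ.* jacobi/ m (a mod m) ∎
  where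
  open ≡-Reasoning
  m = suc (n ^ 2)
  a = suc (toℕ j) ℕ.+ toℕ i ℕ.* n
  b = suc (toℕ (opposite i)) ℕ.+ toℕ j ℕ.* n

theorem3 : (n : ℕ) → 0 < n → 2 ∣ n →
    let m = suc (n ^ 2) in
    (n % 4 ≡ 0 → jacobiMatrix m (ρ (Q n)) ≋ jacobiMatrix m (Q n)) ×
    (n % 4 ≡ 2 → jacobiMatrix m (ρ (Q n)) ≋ (-ᴹ jacobiMatrix m (Q n)))
theorem3 n _ 2∣n =
    (λ n%4≡0 i j → let x = jacobiMatrix (suc (n ^ 2)) (Q n) i j in
      trans (jacobi-rotated n 2∣n i j)
        (trans (cong (ℤ._* x) (jacobi-n≡1 n 2∣n n%4≡0)) (ℤₚ.*-identityˡ x)))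
  , (λ n%4≡2 i j → let x = jacobiMatrix (suc (n ^ 2)) (Q n) i j in
      trans (jacobi-rotated n 2∣n i j)
        (trans (cong (ℤ._* x) (jacobi-n≡-1 n 2∣n n%4≡2)) (ℤₚ.-1*i≡-i x)))
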